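{- Fix $n\ge 1$. Consider the standard box-ball system with $n$ balls, and let $s$ be any state and $T(s)$ the state obtained from $s$ by one step of time evolution. Let $(P(s),Q(s))$ denote the pair of tableaux attached to $s$ by the RSK correspondence. Then: (1) $P(T(s))=P(s)$, i.e. the $P$-symbol is a conserved quantity of the time evolution; (2) the $Q$-symbol evolves independently of the $P$-symbol: for any two states $s_1,s_2$ with $Q(s_1)=Q(s_2)$ one has $Q(T(s_1))=Q(T(s_2))$.
   Context: Standard box-ball system (BBS): boxes are indexed by $\mathbf{Z}$, each box has capacity one, and there are $n$ balls of $n$ distinct colors $1,2,\dots,n$. A state is an assignment of the $n$ balls to $n$ distinct boxes; equivalently a sequence $(a_i)_{i\in\mathbf{Z}}$ with $a_i\in\{1,\dots,n,e\}$, where $e=n+1$ denotes an empty box, in which each color $1,\dots,n$ occurs exactly once. One step of time evolution: every ball is moved exactly once; first the ball of color $1$ is moved to the nearest empty box to its right, then the ball of color $2$ is moved to the nearest empty box to its right (in the configuration after color 1 has moved), and so on for colors $3,\dots,n$ in this order. Bi-word of a state: list the occupied boxes $i_1<i_2<\dots<i_n$ and form the two-rowed array with top row $i_1,\dots,i_n$ and bottom row $a_{i_1},\dots,a_{i_n}$. RSK: the $P$-symbol is the tableau obtained by successively row-inserting (Schensted bumping) $a_{i_1},a_{i_2},\dots,a_{i_n}$ into the empty tableau; the $Q$-symbol is the tableau of the same shape obtained by writing $i_k$ in the box newly created when $a_{i_k}$ is inserted. Row insertion of $x$ into a tableau: if no entry of the first row is larger than $x$, append $x$ to the end of the row; otherwise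 replace the leftmost entry larger than $x$ by $x$ and insert the replaced entry into the next row in the same way. -}

module Defs where

open import Data.Bool using (Bool; true; false; if_then_else_; _∨_)
open import Data.Nat as ℕ using (ℕ; zero; suc)
open import Data.Integer as ℤ using (ℤ; _+_; 1ℤ)
open import Data.Fin using (Fin; toℕ)
open import Data.List using (List; []; _∷_; _++_; [_]; foldl)
open import Data.Bool.ListAction using (any)
open import Data.Vec as V using (Vec; lookup; toList; allFin; _[_]≔_)
open import Data.Product using (_×_; _,_; proj₁; proj₂)
open import Data.Maybe using (Maybe; just; nothing)
open import Relation.Nullary.Decidable using (⌊_⌋)

-- A state of the BBS with n balls: the vector of positions (boxes in ℤ)
-- of the balls; entry i is the box of the ball of colour (toℕ i + 1).
-- States are those vectors whose entries are pairwise distinct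
-- (imposed as a hypothesis in the theorem).
Positions : ℕ → Set
Positions n = Vec ℤ n

colour : ∀ {n} → Fin n → ℕ
colour i = suc (toℕ i)

occupied : List ℤ → ℤ → Bool
occupied occ x = any (λ y → ⌊ y ℤ.≟ x ⌋) occ

-- nearest empty box strictly to the right of p, searching at most
-- `fuel` boxes.  With fuel n+1 and n balls this is exact, since among
-- the n+1 boxes p+1,…,p+n+1 at most n-1 are occupied by other balls.
nextEmpty : ℕ → List ℤ → ℤ → ℤ
nextEmpty zero    occ p = p + 1ℤ
nextEmpty (suc f) occ p =
  if occupied occ (p + 1ℤ) then nextEmpty f occ (p + 1ℤ) else p + 1ℤ

moveBall : ∀ {n} → Positions n → Fin n → Positions n
moveBall {n} s i = s [ i ]≔ nextEmpty (suc n) (toList s) (lookup s i)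

T : ∀ {n} → Positions n → Positions n
T {n} s = foldl moveBall s (toList (allFin n))

insertByPos : ℤ × ℕ → List (ℤ × ℕ) → List (ℤ × ℕ)
insertByPos p [] = [ p ]
insertByPos p (q ∷ qs) =
  if proj₁ p ℤ.≤ᵇ proj₁ q then p ∷ q ∷ qs else q ∷ insertByPos p qs

sortByPos : List (ℤ × ℕ) → List (ℤ × ℕ)
sortByPos [] = []
sortByPos (p ∷ ps) = insertByPos p (sortByPos ps)

biword : ∀ {n} → Positions n → List (ℤ × ℕ)
biword {n} s = sortByPos (toList (V.map (λ i → lookup s i , colour i) (allFin n)))

-- RSK (row insertion); a tableau is the list of its rows, top row first

Tableau : Set → Set
Tableau A = List (List A)

rowInsert : ℕ → List ℕ → List ℕ × Maybe ℕ
rowInsert x [] = [ x ] , nothing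
rowInsert x (y ∷ ys) with x ℕ.<ᵇ y
... | true  = x ∷ ys , just y
... | false with rowInsert x ys
...   | r , b = y ∷ r , b

tabInsert : ℕ → Tableau ℕ → Tableau ℕ × ℕ
tabInsert x [] = [ x ] ∷ [] , 0
tabInsert x (r ∷ rs) with rowInsert x r
... | r' , nothing = r' ∷ rs , 0
... | r' , just y with tabInsert y rs
...   | rs' , k = r' ∷ rs' , suc k

addBox : {A : Set} → ℕ → A → Tableau A → Tableau A
addBox zero    v []       = [ v ] ∷ []
addBox zero    v (r ∷ rs) = (r ++ [ v ]) ∷ rs
addBox (suc k) v []       = [ v ] ∷ []
addBox (suc k) v (r ∷ rs) = r ∷ addBox k v rs

rskStep : Tableau ℕ × Tableau ℤ → ℤ × ℕ → Tableau ℕ × Tableau ℤ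
rskStep (p , q) (i , a) with tabInsert a p
... | p' , k = p' , addBox k i q

rsk : List (ℤ × ℕ) → Tableau ℕ × Tableau ℤ
rsk w = foldl rskStep ([] , []) w

Psym : ∀ {n} → Positions n → Tableau ℕ
Psym s = proj₁ (rsk (biword s))

Qsym : ∀ {n} → Positions n → Tableau ℤ
Qsym s = proj₂ (rsk (biword s))

{-# OPTIONS --safe #-}
-- Both RSK row insertion and the box-ball step are readings of one grid with a row for each colour and a
-- column for each box: inserting the positions, in order of colour, into an empty row is the first step of
-- RSK, and inserting them into the row of empty boxes is T, the bumped letters being the new positions.
-- The local rule of the grid is symmetric.
--
-- Applied to RSK, the symmetry says that Q(s) is the insertion tableau of the position word x.  By Knuth's
-- theorem Q(s) thus determines x up to Knuth equivalence, hence also the row of empty boxes, and inserting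
-- Knuth equivalent words into the same row bumps Knuth equivalent words: this is (2).
--
-- Applied to T, it replaces the row of boxes by a carrier of colours which travels to the right; each of its
-- steps is a Knuth equivalence C·a ~ b·C′, or moves the first letter of C out.  The carrier is empty at both
-- ends, so the colour words of s and T(s) are Knuth equivalent: this is (1).
module Submission where

open import Defs
open import Data.Bool as Bool using (Bool; true; false; not; _∧_; _∨_; if_then_else_)
open import Data.Bool.Properties using (∧-comm; ∧-identityʳ; ∨-zeroʳ; not-¬; not-injective)
open import Data.Nat using (ℕ; zero; suc; _≥_; _+_; _≤_; _<_; _∸_; _<ᵇ_; z≤n; s≤s; _<?_; _≟_)
open import Data.Nat.Properties hiding (_≟_; _<?_)
open import Data.Integer as ℤ using (ℤ; 0ℤ; 1ℤ)
import Data.Integer.Properties as ℤ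
open import Algebra.Properties.AbelianGroup ℤ.+-0-abelianGroup using (∙-cancelˡ)
open import Data.Fin as Fin using (Fin; zero; suc; toℕ)
open import Data.Fin.Properties using (any?; pigeonhole; toℕ-injective; toℕ<n)
open import Data.Vec as V using ([]; _∷_; lookup; toList; _[_]≔_)
open import Data.Vec.Properties using (lookup∘update; lookup∘update′; tabulate-allFin)
open import Data.Vec.Membership.Propositional.Properties using (∈-lookup; ∈-toList⁺)
open import Data.List.Relation.Unary.Unique.Propositional using (Unique)
open import Data.List as List using (List; []; _∷_; _++_; [_]; length; map; foldl; fromMaybe)
open import Data.List.Properties using (∷-injective; ++-assoc; ++-identityʳ; map-∘; map-id; map-injective)
open import Data.List.Membership.Propositional using (_∈_)
open import Data.List.Membership.Propositional.Properties
  using (∈-map⁺; ∈-map⁻; ∈-++⁺ˡ; ∈-++⁺ʳ; ∈-++⁻; ∈-tabulate⁺; ∈-tabulate⁻)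
open import Data.List.Relation.Unary.AllPairs.Properties using (tabulate⁺)
open import Data.List.Relation.Unary.Any using (here; there)
open import Data.List.Relation.Unary.All as All using (All; []; _∷_)
open import Data.List.Relation.Unary.AllPairs using (AllPairs; []; _∷_)
open import Data.Maybe using (Maybe; just; nothing; is-nothing)
open import Data.Product using (∃; ∃-syntax; _×_; _,_; proj₁; proj₂; swap)
open import Function using (id; _∘_; flip)
open import Relation.Nullary using (Dec; does; yes; no; ¬_; contradiction)
open import Relation.Nullary.Decidable using (dec-true; _×-dec_)
open import Relation.Binary.PropositionalEquality hiding ([_])
open import Data.Sum using (_⊎_; inj₁; inj₂)
open import Data.Empty using (⊥; ⊥-elim)
open import Relation.Binary.Definitions using (tri<; tri≈; tri>)

-- Knuth equivalence.

Word : Set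
Word = List ℕ

infix 4 _~_

-- The plactic congruence: the last two constructors are Knuth's relations with the right context
-- `u` built in, and `~-cons` supplies left contexts.
data _~_ : Word → Word → Set where
  ~-refl  : ∀ {u} → u ~ u
  ~-sym   : ∀ {u v} → u ~ v → v ~ u
  ~-trans : ∀ {u v w} → u ~ v → v ~ w → u ~ w
  ~-cons  : ∀ {x u v} → u ~ v → x ∷ u ~ x ∷ v
  xzy~zxy : ∀ {x y z u} → x ≤ y → y < z → x ∷ z ∷ y ∷ u ~ z ∷ x ∷ y ∷ u
  yxz~yzx : ∀ {x y z u} → x < y → y ≤ z → y ∷ x ∷ z ∷ u ~ y ∷ z ∷ x ∷ u

≡⇒~ : ∀ {u v} → u ≡ v → u ~ v
≡⇒~ refl = ~-refl

++⁺ˡ-~ : ∀ t {u v} → u ~ v → t ++ u ~ t ++ v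
++⁺ˡ-~ []      p = p
++⁺ˡ-~ (_ ∷ t) p = ~-cons (++⁺ˡ-~ t p)

++⁺ʳ-~ : ∀ {u v} t → u ~ v → u ++ t ~ v ++ t
++⁺ʳ-~ t ~-refl        = ~-refl
++⁺ʳ-~ t (~-sym p)     = ~-sym (++⁺ʳ-~ t p)
++⁺ʳ-~ t (~-trans p q) = ~-trans (++⁺ʳ-~ t p) (++⁺ʳ-~ t q)
++⁺ʳ-~ t (~-cons p)    = ~-cons (++⁺ʳ-~ t p)
++⁺ʳ-~ t (xzy~zxy p q) = xzy~zxy p q
++⁺ʳ-~ t (yxz~yzx p q) = yxz~yzx p q

-- Row insertion of one letter.

Sorted : Word → Set
Sorted = AllPairs _≤_

-- The graph of `rowInsert`, so that proofs can recurse on the course of an insertion.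
data Ins (x : ℕ) : Word → Word → Maybe ℕ → Set where
  end   : Ins x [] [ x ] nothing
  here  : ∀ {y ys} → x < y → Ins x (y ∷ ys) (x ∷ ys) (just y)
  there : ∀ {y ys zs b} → y ≤ x → Ins x ys zs b → Ins x (y ∷ ys) (y ∷ zs) b

row⁺ : ℕ → Word → Word
row⁺ x r = proj₁ (rowInsert x r)

bump : ℕ → Word → Maybe ℕ
bump x r = proj₂ (rowInsert x r)

ins : ∀ x r → Ins x r (row⁺ x r) (bump x r)
ins x [] = end
ins x (y ∷ ys) with x <ᵇ y in eq
... | true  = here (<ᵇ⇒< x y (subst Bool.T (sym eq) _))
... | false with rowInsert x ys | ins x ys
...   | _ , _ | p = there (≮⇒≥ λ x<y → subst Bool.T eq (<⇒<ᵇ x<y)) p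

Ins-functional : ∀ {x r r₁ r₂ b₁ b₂} → Ins x r r₁ b₁ → Ins x r r₂ b₂ → r₁ ≡ r₂ × b₁ ≡ b₂
Ins-functional end         end         = refl , refl
Ins-functional (here _)    (here _)    = refl , refl
Ins-functional (here p)    (there q _) = contradiction q (<⇒≱ p)
Ins-functional (there q _) (here p)    = contradiction q (<⇒≱ p)
Ins-functional (there _ p) (there _ q) with Ins-functional p q
... | refl , refl = refl , refl

Ins-All : ∀ {P : ℕ → Set} {x r r′ b} → P x → All P r → Ins x r r′ b → All P r′
Ins-All px pr        end         = px ∷ []
Ins-All px (_ ∷ ps)  (here _)    = px ∷ ps
Ins-All px (p ∷ ps)  (there _ i) = p ∷ Ins-All px ps i

Ins-sorted : ∀ {x r r′ b} → Sorted r → Ins x r r′ b → Sorted r′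
Ins-sorted _        end         = [] ∷ []
Ins-sorted (p ∷ ps) (here x<y)  = All.map (≤-trans (<⇒≤ x<y)) p ∷ ps
Ins-sorted (p ∷ ps) (there y≤x i) = Ins-All y≤x p i ∷ Ins-sorted ps i

bumped-All : ∀ {P : ℕ → Set} {x r r′ b} → All P r → Ins x r r′ (just b) → P b
bumped-All (p ∷ _)  (here _)    = p
bumped-All (_ ∷ ps) (there _ i) = bumped-All ps i

bumped-> : ∀ {x r r′ b} → Ins x r r′ (just b) → x < b
bumped-> (here p)    = p
bumped-> (there _ i) = bumped-> i

Ins-head : ∀ {x r r′ b} → Ins x r r′ b → ∃[ s ] ∃[ t ] r′ ≡ s ∷ t × s ≤ x
Ins-head end         = _ , _ , refl , ≤-refl
Ins-head (here _)    = _ , _ , refl , ≤-refl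
Ins-head (there p _) = _ , _ , refl , p

-- Once `z` is in the row, `y < z` cannot get past it, and every entry that `z` passed is at most
-- `z`.
smaller-bumps-≤ : ∀ {y z r r₁ r₂ b c} → y < z → Ins z r r₁ b → Ins y r₁ r₂ c →
                  ∃[ d ] c ≡ just d × d ≤ z
smaller-bumps-≤ y<z end           (here _)    = _ , refl , ≤-refl
smaller-bumps-≤ y<z end           (there p _) = contradiction p (<⇒≱ y<z)
smaller-bumps-≤ y<z (here _)      (here _)    = _ , refl , ≤-refl
smaller-bumps-≤ y<z (here _)      (there p _) = contradiction p (<⇒≱ y<z)
smaller-bumps-≤ y<z (there p _)   (here _)    = _ , refl , p
smaller-bumps-≤ y<z (there _ i)   (there _ j) = smaller-bumps-≤ y<z i j

-- `z` travels past the place taken by `y`, so what it bumps stood to the right of what `y` bumped.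
bumps-monotone : ∀ {y z r r₁ r₂ b c} → Sorted r → y ≤ z → Ins y r r₁ b → Ins z r₁ r₂ (just c) →
                 ∃[ d ] b ≡ just d × d ≤ c
bumps-monotone _       y≤z end         (here p)    = contradiction p (≤⇒≯ y≤z)
bumps-monotone (p ∷ _) y≤z (here _)    (there _ i) = _ , refl , bumped-All p i
bumps-monotone _       y≤z (here _)    (here p)    = contradiction p (≤⇒≯ y≤z)
bumps-monotone _       y≤z (there q _) (here p)    = contradiction (≤-trans q y≤z) (<⇒≱ p)
bumps-monotone (_ ∷ s) y≤z (there _ i) (there _ j) = bumps-monotone s y≤z i j

-- `x` moves left past one entry at a time by `yxz~yzx`, whose first letter is the entry before the
-- one passed.
insert-smaller-~ : ∀ {x y} ys → x < y → Sorted (y ∷ ys) → y ∷ (ys ++ [ x ]) ~ y ∷ x ∷ ys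
insert-smaller-~ []       _   _             = ~-refl
insert-smaller-~ (z ∷ zs) x<y ((y≤z ∷ _) ∷ s) =
  ~-trans (~-cons (insert-smaller-~ zs (<-≤-trans x<y y≤z) s)) (~-sym (yxz~yzx x<y y≤z))

-- `x` moves left up to the entry it bumps; that entry then moves left to the front by `xzy~zxy`.
Ins-~ : ∀ {x r r′ b} → Sorted r → Ins x r r′ b → r ++ [ x ] ~ fromMaybe b ++ r′
Ins-~ _ end = ~-refl
Ins-~ s (here {ys = ys} x<y) = insert-smaller-~ ys x<y s
Ins-~ (_ ∷ s) (there {b = nothing} _ i) = ~-cons (Ins-~ s i)
Ins-~ (p ∷ s) (there {b = just _} y≤x i) with Ins-head i | Ins-All y≤x p i
-- The new tail begins with some `t` such that `y ≤ t ≤ x`, and `x` is below the bumped letter: `t`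
-- is the last letter of the Knuth relation.
... | _ , _ , refl , t≤x | y≤t ∷ _ =
  ~-trans (~-cons (Ins-~ s i)) (xzy~zxy y≤t (≤-<-trans t≤x (bumped-> i)))

-- Inserting words into a row.

infixr 5 _∷_

-- The third index is the row reached, the fourth the word bumped out. As a relation it lets the
-- three insertions of a Knuth relation be matched together.
data Run : Word → Word → Word → Word → Set where
  []  : ∀ {r} → Run r [] r []
  _∷_ : ∀ {x r r₁ r₂ u o b} → Ins x r r₁ b → Run r₁ u r₂ o → Run r (x ∷ u) r₂ (fromMaybe b ++ o)

final : Word → Word → Word
final r []      = r
final r (x ∷ u) = final (row⁺ x r) u

bumped : Word → Word → Word
bumped r []      = []
bumped r (x ∷ u) = fromMaybe (bump x r) ++ bumped (row⁺ x r) u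

run : ∀ r u → Run r u (final r u) (bumped r u)
run r []      = []
run r (x ∷ u) = ins x r ∷ run (row⁺ x r) u

Run-functional : ∀ {r u r₁ r₂ o₁ o₂} → Run r u r₁ o₁ → Run r u r₂ o₂ → r₁ ≡ r₂ × o₁ ≡ o₂
Run-functional [] [] = refl , refl
Run-functional (i ∷ p) (j ∷ q) with Ins-functional i j
... | refl , refl with Run-functional p q
... | refl , refl = refl , refl

-- All three letters pass the entries before the place where `x` stops, and there the claim descends
-- to the tail; only the head at which `x` stops needs work.
Run-xzy : ∀ {x y z r r′ o} → x ≤ y → y < z → Sorted r →
          Run r (x ∷ z ∷ y ∷ []) r′ o → ∃[ o′ ] Run r (z ∷ x ∷ y ∷ []) r′ o′ × o ~ o′
Run-xzy x≤y y<z _ (end ∷ here p ∷ _) = contradiction (<-≤-trans y<z (<⇒≤ p)) (≤⇒≯ x≤y)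
Run-xzy x≤y y<z _ (end ∷ there _ end ∷ here p ∷ _) = contradiction x≤y (<⇒≱ p)
Run-xzy x≤y y<z _ (end ∷ there _ end ∷ there _ (there p _) ∷ _) = contradiction p (<⇒≱ y<z)
Run-xzy x≤y y<z _ (end ∷ there _ end ∷ there p (here q) ∷ []) =
  _ , end ∷ here (≤-<-trans p q) ∷ there p end ∷ [] , ~-refl
Run-xzy x≤y y<z (_ ∷ s) (there p i ∷ there q j ∷ there q′ k ∷ []) with Run-xzy x≤y y<z s (i ∷ j ∷ k ∷ [])
... | _ , (i′ ∷ j′ ∷ k′ ∷ []) , e = _ , there q i′ ∷ there p j′ ∷ there q′ k′ ∷ [] , e
Run-xzy x≤y y<z _ (there p i ∷ here q ∷ _) =
  contradiction (≤-trans p (≤-trans x≤y (<⇒≤ y<z))) (<⇒≱ q)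
Run-xzy x≤y y<z _ (there p i ∷ there _ _ ∷ here q ∷ _) = contradiction (≤-trans p x≤y) (<⇒≱ q)
Run-xzy x≤y y<z _ (here p ∷ here q ∷ _) = contradiction (≤-trans x≤y (<⇒≤ y<z)) (<⇒≱ q)
Run-xzy x≤y y<z _ (here p ∷ there _ _ ∷ here q ∷ _) = contradiction x≤y (<⇒≱ q)
-- `x` bumps the head `h`. If `z < h`, then `z` coming first would bump `h` itself and be bumped by
-- `x`; otherwise `z` passes the head in either order.
Run-xzy {z = z} x≤y y<z (h≤t ∷ _) (here {h} x<h ∷ there x≤z i ∷ there _ j ∷ []) with z <? h
Run-xzy x≤y y<z _ (here x<h ∷ there x≤z end ∷ there _ (there p _) ∷ []) | yes _ =
  contradiction p (<⇒≱ y<z)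
Run-xzy x≤y y<z _ (here x<h ∷ there x≤z end ∷ there _ (here _) ∷ []) | yes z<h =
  _ , here z<h ∷ here (≤-<-trans x≤y y<z) ∷ there x≤y end ∷ [] , ~-refl
Run-xzy x≤y y<z _ (here x<h ∷ there x≤z (here _) ∷ there _ (there p _) ∷ []) | yes _ =
  contradiction p (<⇒≱ y<z)
Run-xzy x≤y y<z ((h≤s ∷ _) ∷ _) (here x<h ∷ there x≤z (here z<s) ∷ there _ (here _) ∷ []) | yes z<h =
  _ , here z<h ∷ here (≤-<-trans x≤y y<z) ∷ there x≤y (here (<-trans y<z z<s)) ∷ [] ,
  ~-sym (yxz~yzx z<h h≤s)
Run-xzy x≤y y<z ((h≤s ∷ _) ∷ _) (here x<h ∷ there x≤z (there s≤z _) ∷ there _ _ ∷ []) | yes z<h =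
  contradiction (≤-trans h≤s s≤z) (<⇒≱ z<h)
-- Only `h` and the letter bumped by `z` change places in the output; `d`, bumped by `y`, lies
-- between them in value.
Run-xzy x≤y y<z (h≤t ∷ _) (_∷_ {b = _} (here x<h) (there {b = b} x≤z i ∷ there _ j ∷ [])) | no z≮h
  with smaller-bumps-≤ y<z i j
... | d , refl , d≤z = _ , there h≤z i ∷ here x<h ∷ there x≤y j ∷ [] , exchange b i
  where
  h≤z = ≮⇒≥ z≮h
  exchange : ∀ b → Ins _ _ _ b → _ ∷ fromMaybe b ++ d ∷ [] ~ fromMaybe b ++ _ ∷ d ∷ []
  exchange nothing  _ = ~-refl
  exchange (just _) i = xzy~zxy (bumped-All (Ins-All h≤z h≤t i) j) (≤-<-trans d≤z (bumped-> i))

-- Where `x` stops, it acts on the head and `z` on the tail, so exchanging them merely exchanges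
-- their outputs. If both bump, the letter bumped earlier by `y` is the first letter of `yxz~yzx`.
Run-yxz : ∀ {x y z r r′ o} → x < y → y ≤ z → Sorted r →
          Run r (y ∷ x ∷ z ∷ []) r′ o → ∃[ o′ ] Run r (y ∷ z ∷ x ∷ []) r′ o′ × o ~ o′
Run-yxz x<y y≤z _ (end ∷ there p _ ∷ _) = contradiction p (<⇒≱ x<y)
Run-yxz x<y y≤z _ (end ∷ here _ ∷ here p ∷ _) = contradiction (<-≤-trans x<y y≤z) (<⇒≯ p)
Run-yxz x<y y≤z _ (end ∷ here _ ∷ there _ end ∷ []) =
  _ , end ∷ there y≤z end ∷ here x<y ∷ [] , ~-refl
Run-yxz x<y y≤z (_ ∷ s) (there p i ∷ there q j ∷ there q′ k ∷ []) with Run-yxz x<y y≤z s (i ∷ j ∷ k ∷ [])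
... | _ , (i′ ∷ j′ ∷ k′ ∷ []) , e = _ , there p i′ ∷ there q′ j′ ∷ there q k′ ∷ [] , e
Run-yxz x<y y≤z _ (there p i ∷ there q j ∷ here q′ ∷ _) = contradiction (≤-trans p y≤z) (<⇒≱ q′)
Run-yxz x<y y≤z _ (there p i ∷ here q ∷ here q′ ∷ _) = contradiction (<-≤-trans x<y y≤z) (<⇒≯ q′)
Run-yxz x<y y≤z (h≤t ∷ s) (there {b = b₁} h≤y i ∷ here x<h ∷ there {b = b₃} _ k ∷ []) =
  _ , there h≤y i ∷ there (≤-trans h≤y y≤z) k ∷ here x<h ∷ [] , exchange b₁ b₃ i k
  where
  exchange : ∀ b₁ b₃ → Ins _ _ _ b₁ → Ins _ _ _ b₃ →
         fromMaybe b₁ ++ _ ∷ fromMaybe b₃ ++ [] ~ fromMaybe b₁ ++ fromMaybe b₃ ++ _ ∷ []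
  exchange b₁ nothing  i k = ~-refl
  exchange b₁ (just _) i k with bumps-monotone s y≤z i k
  ... | _ , refl , d≤c = yxz~yzx (≤-<-trans h≤y (bumped-> i)) d≤c
Run-yxz x<y y≤z _ (here _ ∷ there p _ ∷ _) = contradiction p (<⇒≱ x<y)
Run-yxz x<y y≤z _ (here _ ∷ here _ ∷ here p ∷ _) = contradiction (<-≤-trans x<y y≤z) (<⇒≯ p)
Run-yxz x<y y≤z (h≤t ∷ _) (here y<h ∷ here _ ∷ there {b = b} _ k ∷ []) =
  _ , here y<h ∷ there y≤z k ∷ here x<y ∷ [] , exchange b k
  where
  exchange : ∀ b → Ins _ _ _ b → _ ∷ _ ∷ fromMaybe b ++ [] ~ _ ∷ fromMaybe b ++ _ ∷ []
  exchange nothing  _ = ~-refl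
  exchange (just _) k = yxz~yzx y<h (bumped-All h≤t k)

final-sorted : ∀ {r} u → Sorted r → Sorted (final r u)
final-sorted []      s = s
final-sorted (x ∷ u) s = final-sorted u (Ins-sorted s (ins x _))

final-++ : ∀ r u v → final r (u ++ v) ≡ final (final r u) v
final-++ r []      v = refl
final-++ r (x ∷ u) v = final-++ (row⁺ x r) u v

bumped-++ : ∀ r u v → bumped r (u ++ v) ≡ bumped r u ++ bumped (final r u) v
bumped-++ r []      v = refl
bumped-++ r (x ∷ u) v =
  trans (cong (fromMaybe (bump x r) ++_) (bumped-++ (row⁺ x r) u v))
        (sym (++-assoc (fromMaybe (bump x r)) _ _))

infix 4 _≈[_]_

_≈[_]_ : Word → Word → Word → Set
u ≈[ r ] v = final r u ≡ final r v × bumped r u ~ bumped r v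

Run⇒≈ : ∀ {r} u v → (∀ {r′ o} → Run r u r′ o → ∃[ o′ ] Run r v r′ o′ × o ~ o′) → u ≈[ r ] v
Run⇒≈ {r} u v f with f (run r u)
... | _ , p , e with Run-functional p (run r v)
... | e₁ , refl = e₁ , e

≈-++ʳ : ∀ {r} u v t → u ≈[ r ] v → u ++ t ≈[ r ] v ++ t
≈-++ʳ {r} u v t (p , q) rewrite final-++ r u t | final-++ r v t | bumped-++ r u t | bumped-++ r v t | p =
  refl , ++⁺ʳ-~ _ q

-- Induction on the derivation; `~-cons` changes the row, so the row stays general. It serves twice:
-- with the empty row in Knuth's theorem, and with the row of empty boxes for the time evolution.
~⇒≈ : ∀ {u v r} → Sorted r → u ~ v → u ≈[ r ] v
~⇒≈ s ~-refl = refl , ~-refl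
~⇒≈ s (~-sym p) with ~⇒≈ s p
... | e , q = sym e , ~-sym q
~⇒≈ s (~-trans p q) with ~⇒≈ s p | ~⇒≈ s q
... | e , p′ | e′ , q′ = trans e e′ , ~-trans p′ q′
~⇒≈ {r = r} s (~-cons {x} p) with ~⇒≈ (Ins-sorted s (ins x r)) p
... | e , q = e , ++⁺ˡ-~ (fromMaybe (bump x r)) q
~⇒≈ {r = r} s (xzy~zxy {x} {y} {z} {u} p q) =
  ≈-++ʳ {r} (x ∷ z ∷ y ∷ []) (z ∷ x ∷ y ∷ []) u (Run⇒≈ _ _ (Run-xzy p q s))
~⇒≈ {r = r} s (yxz~yzx {x} {y} {z} {u} p q) =
  ≈-++ʳ {r} (y ∷ x ∷ z ∷ []) (y ∷ z ∷ x ∷ []) u (Run⇒≈ _ _ (Run-yxz p q s))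

-- `Ins-~` iterated, each bumped letter leaving on the left. From the empty row it splits a word
-- into what the lower rows receive and its first row.
run-~ : ∀ {r} u → Sorted r → r ++ u ~ bumped r u ++ final r u
run-~ {r} []      s = ≡⇒~ (++-identityʳ r)
run-~ {r} (x ∷ u) s =
  ~-trans (≡⇒~ (sym (++-assoc r [ x ] u)))
  (~-trans (++⁺ʳ-~ u (Ins-~ s (ins x r)))
  (~-trans (≡⇒~ (++-assoc b (row⁺ x r) u))
  (~-trans (++⁺ˡ-~ b (run-~ u (Ins-sorted s (ins x r))))
           (≡⇒~ (sym (++-assoc b _ _))))))
  where b = fromMaybe (bump x r)

-- Knuth moves only permute letters. Hence equivalent position words have the same occupied boxes.
~⇒∈ : ∀ {u v x} → u ~ v → (x ∈ u → x ∈ v) × (x ∈ v → x ∈ u)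
~⇒∈ ~-refl = id , id
~⇒∈ (~-sym p) = swap (~⇒∈ p)
~⇒∈ (~-trans p q) with ~⇒∈ p | ~⇒∈ q
... | f , g | f′ , g′ = f′ ∘ f , g ∘ g′
~⇒∈ (~-cons p) with ~⇒∈ p
... | f , g = (λ { (here e) → here e ; (there i) → there (f i) })
            , (λ { (here e) → here e ; (there i) → there (g i) })
~⇒∈ (xzy~zxy _ _) = exchange , exchange
  where
  exchange : ∀ {x a b : ℕ} {u} → x ∈ a ∷ b ∷ u → x ∈ b ∷ a ∷ u
  exchange (here e)          = there (here e)
  exchange (there (here e))  = here e
  exchange (there (there i)) = there (there i)
~⇒∈ (yxz~yzx _ _) = exchange , exchange
  where
  exchange : ∀ {x a b c : ℕ} {u} → x ∈ c ∷ a ∷ b ∷ u → x ∈ c ∷ b ∷ a ∷ u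
  exchange (here e)                  = here e
  exchange (there (here e))          = there (there (here e))
  exchange (there (there (here e)))  = there (here e)
  exchange (there (there (there i))) = there (there (there i))

-- RSK row by row

Biword : Set
Biword = List (ℤ × ℕ)

letters : Biword → Word
letters = map proj₂

extends : ℤ → Maybe ℕ → List ℤ
extends i nothing  = [ i ]
extends i (just _) = []

recorded : Word → Biword → List ℤ
recorded r []            = []
recorded r ((i , a) ∷ w) = extends i (bump a r) ++ recorded (row⁺ a r) w

-- A bumped letter carries the position of the letter that bumped it: this is the bi-word that the
-- second row receives.
bumpedᵇ : Word → Biword → Biword
bumpedᵇ r []            = []
bumpedᵇ r ((i , a) ∷ w) = map (i ,_) (fromMaybe (bump a r)) ++ bumpedᵇ (row⁺ a r) w

letters-bumpedᵇ : ∀ r w → letters (bumpedᵇ r w) ≡ bumped r (letters w)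
letters-bumpedᵇ r []            = refl
letters-bumpedᵇ r ((i , a) ∷ w) with bump a r
... | nothing = letters-bumpedᵇ (row⁺ a r) w
... | just b  = cong (b ∷_) (letters-bumpedᵇ (row⁺ a r) w)

-- The lower rows of both tableaux change only when a letter is bumped, so RSK splits into its
-- action on the first row and RSK of the bumped bi-word.
rsk-cons : ∀ w {r p q} {t : List ℤ} →
  foldl rskStep (r ∷ p , t ∷ q) w ≡
    (final r (letters w) ∷ proj₁ (foldl rskStep (p , q) (bumpedᵇ r w)) ,
     (t ++ recorded r w) ∷ proj₂ (foldl rskStep (p , q) (bumpedᵇ r w)))
rsk-cons []            {t = t} = cong₂ _,_ refl (cong (_∷ _) (sym (++-identityʳ t)))
rsk-cons ((i , a) ∷ w) {r} {p} {t = t} with rowInsert a r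
... | r′ , nothing = trans (rsk-cons w {r = r′} {p} {t = t ++ [ i ]})
                         (cong (λ q′ → _ , q′ ∷ _) (++-assoc t [ i ] (recorded r′ w)))
... | r′ , just b = rsk-cons w

infixr 5 _▹_

-- Prepends a row unless it is empty, so that the tableau of the empty word needs no special case.
_▹_ : ∀ {A : Set} → List A → Tableau A → Tableau A
[]      ▹ t = []
(x ∷ r) ▹ t = (x ∷ r) ∷ t

final-nonempty : ∀ x r u → ∃[ y ] ∃[ t ] final (x ∷ r) u ≡ y ∷ t
final-nonempty x r []      = _ , _ , refl
final-nonempty x r (a ∷ u) with row⁺ a (x ∷ r) | Ins-head (ins a (x ∷ r))
... | _ | y , t , refl , _ = final-nonempty y t u

rsk-rows : ∀ w → rsk w ≡ (final [] (letters w) ▹ proj₁ (rsk (bumpedᵇ [] w)) ,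
                          recorded [] w ▹ proj₂ (rsk (bumpedᵇ [] w)))
rsk-rows [] = refl
rsk-rows ((i , a) ∷ w)
  with final [ a ] (letters w) | final-nonempty a [] (letters w) | rsk-cons w {r = [ a ]} {[]} {[]} {[ i ]}
... | _ | _ , _ , refl | e = e

-- The insertion tableau and Knuth's theorem.

P : Word → Tableau ℕ
P = foldl (λ t x → proj₁ (tabInsert x t)) []

rsk-P : ∀ w → proj₁ (rsk w) ≡ P (letters w)
rsk-P = go [] []
  where
  go : ∀ p q w → proj₁ (foldl rskStep (p , q) w) ≡ foldl (λ t x → proj₁ (tabInsert x t)) p (letters w)
  go p q []            = refl
  go p q ((i , a) ∷ w) = go _ _ w

P-rows : ∀ u → P u ≡ final [] u ▹ P (bumped [] u)
P-rows u = begin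
  P u                                             ≡⟨ cong P (sym letters-w) ⟩
  P (letters w)                                   ≡⟨ rsk-P w ⟨
  proj₁ (rsk w)                                   ≡⟨ cong proj₁ (rsk-rows w) ⟩
  final [] (letters w) ▹ proj₁ (rsk (bumpedᵇ [] w)) ≡⟨ cong (final [] (letters w) ▹_) (rsk-P (bumpedᵇ [] w)) ⟩
  final [] (letters w) ▹ P (letters (bumpedᵇ [] w)) ≡⟨ cong (λ v → final [] (letters w) ▹ P v) (letters-bumpedᵇ [] w) ⟩
  final [] (letters w) ▹ P (bumped [] (letters w)) ≡⟨ cong (λ v → final [] v ▹ P (bumped [] v)) letters-w ⟩
  final [] u ▹ P (bumped [] u)                    ∎
  where
  open ≡-Reasoning
  -- Dummy positions turn the word into a bi-word to which `rsk-rows` applies.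
  w = map (0ℤ ,_) u
  letters-w : letters w ≡ u
  letters-w = trans (sym (map-∘ u)) (map-id u)

length-bumped : ∀ r u → length (bumped r u) ≤ length u
length-bumped r []      = z≤n
length-bumped r (x ∷ u) with bump x r
... | nothing = m≤n⇒m≤1+n (length-bumped (row⁺ x r) u)
... | just _  = s≤s (length-bumped (row⁺ x r) u)

-- The first letter put into an empty row bumps nothing, so every induction over the rows of a
-- tableau terminates.
length-bumped-[] : ∀ {k} u → length u ≤ suc k → length (bumped [] u) ≤ k
length-bumped-[] []      _       = z≤n
length-bumped-[] (x ∷ u) (s≤s p) = ≤-trans (length-bumped [ x ] u) p

-- Row by row: by `~⇒≈` the first rows agree and the bumped words are again equivalent.
~⇒P≡ : ∀ {u v} → u ~ v → P u ≡ P v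
~⇒P≡ {u} {v} = go (length u + length v) (m≤m+n _ _) (m≤n+m _ (length u))
  where
  go : ∀ k {u v} → length u ≤ k → length v ≤ k → u ~ v → P u ≡ P v
  go zero    {[]} {[]} _ _ _ = refl
  go (suc k) {u} {v} p q e with ~⇒≈ [] e
  ... | f , b rewrite P-rows u | P-rows v =
    cong₂ _▹_ f (go k (length-bumped-[] u p) (length-bumped-[] v q) b)

reading : Tableau ℕ → Word
reading []      = []
reading (r ∷ t) = reading t ++ r

-- `run-~` from the empty row peels off the first row; the bumped word is treated recursively.
~reading-P : ∀ u → u ~ reading (P u)
~reading-P u = go (length u) u ≤-refl
  where
  go : ∀ k u → length u ≤ k → u ~ reading (P u)
  go _       []      _ = ~-refl
  go (suc k) (x ∷ u) p with final [ x ] u | final-nonempty x [] u | run-~ {[]} (x ∷ u) [] | P-rows (x ∷ u)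
  ... | _ | _ , _ , refl | e | rows rewrite rows =
    ~-trans e (++⁺ʳ-~ _ (go k (bumped [ x ] u) (length-bumped-[] (x ∷ u) p)))

P≡⇒~ : ∀ {u v} → P u ≡ P v → u ~ v
P≡⇒~ {u} {v} e = ~-trans (~reading-P u) (~-trans (≡⇒~ (cong reading e)) (~-sym (~reading-P v)))

-- The box-ball grid

Bits : Set
Bits = ℕ → Bool

Matrix : Set
Matrix = ℕ → ℕ → Bool

-- The true places of `p` in the window from `k` to `k + l - 1`, as an increasing word: a row of the
-- grid read as a tableau row.
bits : ℕ → ℕ → Bits → Word
bits k zero    p = []
bits k (suc l) p = if p k then k ∷ bits (suc k) l p else bits (suc k) l p

bits-false : ∀ {k} l p → p k ≡ false → bits k (suc l) p ≡ bits (suc k) l p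
bits-false _ _ pk rewrite pk = refl

bits-step : ∀ {k} l p q → p k ≡ q k → bits (suc k) l p ≡ bits (suc k) l q →
            bits k (suc l) p ≡ bits k (suc l) q
bits-step _ p q e es rewrite e | es = refl

bits-[]⁻ : ∀ k l p → bits k (suc l) p ≡ [] → p k ≡ false × bits (suc k) l p ≡ []
bits-[]⁻ k l p e with p k
... | false = refl , e

∈-bits⁻ : ∀ {k} l {p x} → x ∈ bits k l p → k ≤ x × x < k + l × p x ≡ true
∈-bits⁻ {k} (suc l) {p} i rewrite +-suc k l with p k in pk
∈-bits⁻ {k} (suc l) (here refl) | true = ≤-refl , s≤s (m≤m+n k l) , pk
∈-bits⁻ {k} (suc l) (there i)   | true with ∈-bits⁻ l i
... | a , b , c = <⇒≤ a , b , c
∈-bits⁻ {k} (suc l) i           | false with ∈-bits⁻ l i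
... | a , b , c = <⇒≤ a , b , c

∈-bits⁺ : ∀ {k} l {p x} → k ≤ x → x < k + l → p x ≡ true → x ∈ bits k l p
∈-bits⁺ {k} zero k≤x x<k px rewrite +-identityʳ k = contradiction k≤x (<⇒≱ x<k)
∈-bits⁺ {k} (suc l) {p} {x} k≤x x<k px rewrite +-suc k l with m≤n⇒m<n∨m≡n k≤x
... | inj₂ refl rewrite px = here refl
... | inj₁ k<x with p k
...   | true  = there (∈-bits⁺ l k<x x<k px)
...   | false = ∈-bits⁺ l k<x x<k px

bits-sorted : ∀ k l p → Sorted (bits k l p)
bits-sorted k zero    p = []
bits-sorted k (suc l) p with p k
... | true  = All.tabulate (λ i → <⇒≤ (proj₁ (∈-bits⁻ l i))) ∷ bits-sorted (suc k) l p
... | false = bits-sorted (suc k) l p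

bits-none : ∀ k l p → (∀ {x} → x < k + l → p x ≡ false) → bits k l p ≡ []
bits-none k zero    _ _  = refl
bits-none k (suc l) p h rewrite +-suc k l =
  trans (bits-false l p (h (s≤s (m≤m+n k l)))) (bits-none (suc k) l p h)

bits-cong : ∀ k l p q → (∀ {x} → x < k + l → p x ≡ q x) → bits k l p ≡ bits k l q
bits-cong k zero    _ _ _ = refl
bits-cong k (suc l) p q h rewrite +-suc k l =
  bits-step l p q (h (s≤s (m≤m+n k l))) (bits-cong (suc k) l p q h)

-- A cell with entry p receives a bit f from the left (a letter in flight) and a bit r from above (a free
-- box, or a letter of the row).  An entry launches a letter and leaves r = 1, a letter in flight settles
-- where r = 1, and all else passes.  The rule is symmetric: carry p f r leaves to the right and
-- carry p r f downwards.
carry : Bool → Bool → Bool → Bool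
carry p f r = p ∨ (f ∧ not r)

settle : Bool → Bool → Bool → Bool
settle p f r = not p ∧ (f ∧ r)

-- One line of the grid by itself, so that the same lemmas serve rows and, after transposition,
-- columns.
module Scan (M f r r′ o : Bits)
            (f-step : ∀ j → f (suc j) ≡ carry (M j) (f j) (r j))
            (r-step : ∀ j → r′ j ≡ carry (M j) (r j) (f j))
            (o-step : ∀ j → o j ≡ settle (M j) (f j) (r j)) where

  idle : ∀ k l → f k ≡ false → bits k l M ≡ [] →
         f (k + l) ≡ false × bits k l r′ ≡ bits k l r × bits k l o ≡ []
  idle k zero fk _ rewrite +-identityʳ k = fk , refl , refl
  idle k (suc l) fk e with bits-[]⁻ k l M e
  ... | mk , e′ with idle (suc k) l (trans (f-step k) (cong₂ (λ p f → carry p f (r k)) mk fk)) e′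
  ... | fl , er , eo rewrite +-suc k l =
    fl
    , bits-step l r′ r (trans (r-step k) (trans (cong₂ (λ p f → carry p (r k) f) mk fk) (∧-identityʳ _))) er
    , trans (bits-false l o (trans (o-step k) (cong₂ (λ p f → settle p f (r k)) mk fk))) eo

  fly : ∀ k l → f k ≡ true → bits k l M ≡ [] →
        (f (k + l) ≡ true × bits k l r ≡ [] × bits k l r′ ≡ [] × bits k l o ≡ [])
        ⊎ ∃[ c ] f (k + l) ≡ false × bits k l r ≡ c ∷ bits k l r′ × bits k l o ≡ [ c ]
  fly k zero fk _ rewrite +-identityʳ k = inj₁ (fk , refl , refl , refl)
  fly k (suc l) fk e with bits-[]⁻ k l M e | r k in rk | f-step k | r-step k | o-step k
  ... | mk , e′ | true | fs | rs | os rewrite mk | fk with idle (suc k) l fs e′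
  ...   | fl , er , eo rewrite +-suc k l | rs | os | er | eo = inj₂ (k , fl , refl , refl)
  fly k (suc l) fk e
      | mk , e′ | false | fs | rs | os rewrite mk | fk | rs | os | +-suc k l = fly (suc k) l fs e′

  -- The local rule performs a row insertion: `q` enters the row, and the flight launched there
  -- removes the next entry to the right and puts it out. A flight that survives the window means
  -- that the row has grown.
  point : ∀ k l {q} → f k ≡ false → bits k l M ≡ [ q ] → r q ≡ false →
          ∃[ b ] Ins q (bits k l r) (bits k l r′) b × bits k l o ≡ fromMaybe b × f (k + l) ≡ is-nothing b
  point k (suc l) fk e rq with M k in mk | f-step k | r-step k | o-step k
  point k (suc l) fk e rq | true | fs | rs | os with ∷-injective e
  ... | refl , e′ with fly (suc k) l fs e′
  ... | inj₁ (fl , er , er′ , eo) rewrite rq | rs | os | +-suc k l | er | er′ | eo =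
    nothing , end , refl , fl
  ... | inj₂ (c , fl , er , eo) rewrite rq | rs | os | +-suc k l | er | eo =
    just c , here (proj₁ (∈-bits⁻ l (subst (c ∈_) (sym er) (here refl)))) , refl , fl
  point k (suc l) {q} fk e rq | false | fs | rs | os rewrite fk
    with point (suc k) l fs e rq
  ... | b , i , eo , fl rewrite os | +-suc k l with r k
  ...   | true  rewrite rs = b , there (<⇒≤ (proj₁ (∈-bits⁻ l (subst (q ∈_) (sym e) (here refl))))) i , eo , fl
  ...   | false rewrite rs = b , i , eo , fl

  source : ∀ {k j} → k ≤ j → f j ≡ true → f k ≡ true ⊎ ∃[ q ] k ≤ q × q < j × M q ≡ true
  source {j = zero} z≤n e = inj₁ e
  source {j = suc j} k≤j e with m≤n⇒m<n∨m≡n k≤j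
  ... | inj₂ refl = inj₁ e
  ... | inj₁ (s≤s k≤j′) with M j in mj | f j in fj | f-step j
  ...   | true  | _     | _  = inj₂ (j , k≤j′ , ≤-refl , mj)
  ...   | false | false | fs = contradiction (trans (sym fs) e) λ ()
  ...   | false | true  | _ with source k≤j′ fj
  ...     | inj₁ fk = inj₁ fk
  ...     | inj₂ (q , a , b , c) = inj₂ (q , a , m<n⇒m<1+n b , c)

  settled : ∀ {j} → o j ≡ true → f j ≡ true × r j ≡ true × f (suc j) ≡ false
  settled {j} e with M j | f j | r j | o-step j | f-step j
  ... | true  | _     | _     | os | _  = contradiction (trans (sym os) e) λ ()
  ... | false | false | _     | os | _  = contradiction (trans (sym os) e) λ ()
  ... | false | true  | false | os | _  = contradiction (trans (sym os) e) λ ()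
  ... | false | true  | true  | _  | fs = refl , refl , fs

-- Grids, their boundaries and their words.

record Grid (M F R O : Matrix) : Set where
  field
    right : ∀ i j → F i (suc j) ≡ carry (M i j) (F i j) (R i j)
    down  : ∀ i j → R (suc i) j ≡ carry (M i j) (R i j) (F i j)
    out   : ∀ i j → O i j ≡ settle (M i j) (F i j) (R i j)

transpose : ∀ {M F R O} → Grid M F R O → Grid (flip M) (flip R) (flip F) (flip O)
transpose {M} {F} {R} G = record
  { right = λ j i → down i j
  ; down  = λ j i → right i j
  ; out   = λ j i → trans (out i j) (cong (not (M i j) ∧_) (∧-comm (F i j) (R i j)))
  }
  where open Grid G

RowUnique : Matrix → Set
RowUnique M = ∀ {i j j′} → M i j ≡ true → M i j′ ≡ true → j ≡ j′

-- A point may only enter where neither a ball in flight nor a box of the row comes in from the boundary.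
record Admissible (M F R : Matrix) : Set where
  field
    row-unique : RowUnique M
    col-unique : RowUnique (flip M)
    left-clear : ∀ {i j} → M i j ≡ true → F i 0 ≡ false
    top-clear  : ∀ {i j} → M i j ≡ true → R 0 j ≡ false

transpose-admissible : ∀ {M F R} → Admissible M F R → Admissible (flip M) (flip R) (flip F)
transpose-admissible A = record
  { row-unique = col-unique ; col-unique = row-unique ; left-clear = top-clear ; top-clear = left-clear }
  where open Admissible A

unique-bits : ∀ {p} k l → (∀ {x y} → p x ≡ true → p y ≡ true → x ≡ y) →
              bits k l p ≡ [] ⊎ ∃[ q ] bits k l p ≡ [ q ] × p q ≡ true
unique-bits k zero u = inj₁ refl
unique-bits {p} k (suc l) u with p k in pk
... | false = unique-bits (suc k) l u
... | true with bits (suc k) l p in e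
...   | []    = inj₂ (k , refl , pk)
...   | y ∷ _ with ∈-bits⁻ l (subst (y ∈_) (sym e) (here refl))
...     | k<y , _ , py = contradiction (u pk py) (<⇒≢ k<y)

-- The bi-word of a 0-1 matrix, row `h` labelled `g h`. With colours as rows it lists positions;
-- flipped, with boxes as rows, it lists colours.
rowWord : (ℕ → ℤ) → ℕ → ℕ → ℕ → Matrix → Biword
rowWord g k zero    m M = []
rowWord g k (suc l) m M = map (g k ,_) (bits 0 m (M k)) ++ rowWord g (suc k) l m M

letters-row : ∀ (i : ℤ) u w → letters (map (i ,_) u ++ w) ≡ u ++ letters w
letters-row i []      w = refl
letters-row i (x ∷ u) w = cong (x ∷_) (letters-row i u w)

module GridProperties {M F R O} (G : Grid M F R O) (A : Admissible M F R) where
  open Grid G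
  open Admissible A

  module Row i = Scan (M i) (F i) (R i) (R (suc i)) (O i) (right i) (down i) (out i)
  module Col j = Scan (flip M j) (flip R j) (flip F j) (flip F (suc j)) (flip O j)
                      (λ i → down i j) (λ i → right i j) (Grid.out (transpose G) j)

  -- A set bit above an entry would come down the column either from the top boundary or from a
  -- second entry of that column.
  R-clear : ∀ {i j} → M i j ≡ true → R i j ≡ false
  R-clear {i} {j} m with R i j in r
  ... | false = refl
  ... | true with Col.source j z≤n r
  ...   | inj₁ r₀ = trans (sym r₀) (top-clear m)
  ...   | inj₂ (h , _ , h<i , m′) = contradiction (col-unique m′ m) (<⇒≢ h<i)

  -- A flight ends where it settles, so settling again takes an entry in between; but then the first
  -- flight, too, came from an entry, and the row has only one. This makes the output a matrix to
  -- which the argument applies again.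
  settles-once : ∀ {i j j′} → O i j ≡ true → j < j′ → O i j′ ≡ true → ⊥
  settles-once {i} o j<j′ o′ with Row.settled i o | Row.settled i o′
  ... | fj , _ , fsj | fj′ , _ with Row.source i j<j′ fj′ | Row.source i z≤n fj
  ... | inj₁ t | _ = contradiction (trans (sym fsj) t) λ ()
  ... | inj₂ (_ , _ , _ , m) | inj₁ t = contradiction (trans (sym (left-clear m)) t) λ ()
  ... | inj₂ (_ , j<q , _ , m) | inj₂ (_ , _ , q′<j , m′) =
    contradiction (row-unique m′ m) (<⇒≢ (<-trans q′<j j<q))

  out-unique : RowUnique O
  out-unique {j = j} {j′} o o′ with <-cmp j j′
  ... | tri< a _ _ = ⊥-elim (settles-once o a o′)
  ... | tri≈ _ b _ = b
  ... | tri> _ _ c = ⊥-elim (settles-once o′ c o)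

  module _ (m : ℕ) where

    -- A row with an entry is a row insertion. Without an entry, an incoming flight just moves the
    -- first letter of the row out, and the word stays the same; the carrier does this at an empty
    -- box.
    row-~ : ∀ i → bits 0 m (R i) ++ bits 0 m (M i) ~ bits 0 m (O i) ++ bits 0 m (R (suc i))
    row-~ i with unique-bits {M i} 0 m row-unique
    ... | inj₂ (q , e , mq) with Row.point i 0 m (left-clear mq) e (R-clear mq)
    ...   | b , p , eo , _ rewrite e | eo = Ins-~ (bits-sorted 0 m (R i)) p
    row-~ i | inj₁ e rewrite e with F i 0 in f
    ... | false with Row.idle i 0 m f e
    ...   | _ , er , eo rewrite er | eo = ≡⇒~ (++-identityʳ _)
    row-~ i | inj₁ e | true with Row.fly i 0 m f e
    ... | inj₁ (_ , er , er′ , eo) rewrite er | er′ | eo = ~-refl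
    ... | inj₂ (_ , _ , er , eo) rewrite er | eo = ≡⇒~ (++-identityʳ _)

    module _ (g : ℕ → ℤ) where

      rows-~ : ∀ k l → bits 0 m (R k) ++ letters (rowWord g k l m M) ~
                       letters (rowWord g k l m O) ++ bits 0 m (R (k + l))
      rows-~ k zero rewrite +-identityʳ k = ≡⇒~ (++-identityʳ _)
      rows-~ k (suc l)
        rewrite +-suc k l =
        ~-trans (≡⇒~ (cong (bits 0 m (R k) ++_) (letters-row (g k) (bits 0 m (M k)) _)))
        (~-trans (≡⇒~ (sym (++-assoc (bits 0 m (R k)) _ _)))
        (~-trans (++⁺ʳ-~ _ (row-~ k))
        (~-trans (≡⇒~ (++-assoc (bits 0 m (O k)) _ _))
        (~-trans (++⁺ˡ-~ (bits 0 m (O k)) (rows-~ (suc k) l))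
        (~-trans (≡⇒~ (sym (++-assoc (bits 0 m (O k)) _ _)))
                 (≡⇒~ (cong (_++ bits 0 m (R (suc k + l))) (sym (letters-row (g k) (bits 0 m (O k)) _)))))))))

      module _ (F₀ : ∀ i → F i 0 ≡ false) where

        -- The first row of RSK read off the grid: the final row is the lower boundary, the recorded
        -- positions are the flights leaving on the right, and the bumped bi-word is the output.
        rows-run : ∀ k l →
          final (bits 0 m (R k)) (letters (rowWord g k l m M)) ≡ bits 0 m (R (k + l)) ×
          recorded (bits 0 m (R k)) (rowWord g k l m M) ≡ map g (bits k l (λ i → F i m)) ×
          bumpedᵇ (bits 0 m (R k)) (rowWord g k l m M) ≡ rowWord g k l m O
        rows-run k zero rewrite +-identityʳ k = refl , refl , refl
        rows-run k (suc l) rewrite +-suc k l with unique-bits {M k} 0 m row-unique | rows-run (suc k) l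
        ... | inj₁ e | fin , rec , bum with Row.idle k 0 m (F₀ k) e
        ...   | fl , er , eo rewrite e | eo | fl | er = fin , rec , bum
        rows-run k (suc l) | inj₂ (q , e , mq) | fin , rec , bum
          with Row.point k 0 m (F₀ k) e (R-clear mq)
        ... | b , p , eo , fl with Ins-functional (ins q (bits 0 m (R k))) p
        ... | er , eb rewrite e | eo | er | eb with b
        ...   | nothing rewrite fl = fin , cong (g k ∷_) rec , bum
        ...   | just c  rewrite fl = fin , rec , cong ((g k , c) ∷_) bum

-- The grid of given boundaries and the symmetry of RSK.

mutual
  flight : Matrix → Bits → Bits → Matrix
  flight M f₀ r₀ i zero    = f₀ i
  flight M f₀ r₀ i (suc j) = carry (M i j) (flight M f₀ r₀ i j) (resting M f₀ r₀ i j)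

  resting : Matrix → Bits → Bits → Matrix
  resting M f₀ r₀ zero    j = r₀ j
  resting M f₀ r₀ (suc i) j = carry (M i j) (resting M f₀ r₀ i j) (flight M f₀ r₀ i j)

grid : ∀ M f₀ r₀ → Grid M (flight M f₀ r₀) (resting M f₀ r₀)
                         (λ i j → settle (M i j) (flight M f₀ r₀ i j) (resting M f₀ r₀ i j))
grid M f₀ r₀ = record { right = λ _ _ → refl ; down = λ _ _ → refl ; out = λ _ _ → refl }

none : Bits
none _ = false

-- The symmetry of RSK: flip M is the matrix of the inverse biword.
rsk-transpose : ∀ g g′ n m k {M} → RowUnique M → RowUnique (flip M) →
  length (letters (rowWord g′ 0 n m M)) ≤ k →
  proj₂ (rsk (rowWord g 0 m n (flip M))) ≡ map (map g) (P (letters (rowWord g′ 0 n m M)))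
rsk-transpose g g′ n m k {M} ru cu len
  with admissible ← record { row-unique = ru ; col-unique = cu
                           ; left-clear = λ _ → refl {x = false} ; top-clear = λ _ → refl {x = false} }
  -- `fin` and `rec` describe the same lower boundary: as the first row of the insertion tableau,
  -- and as the first row of the recording tableau of the transpose.
  with (fin , _ , bum) ← GridProperties.rows-run (grid M none none) admissible m g′ (λ _ → refl) 0 n
     | (_ , rec , bumᵀ) ← GridProperties.rows-run (transpose (grid M none none))
                            (transpose-admissible admissible) n g (λ _ → refl) 0 m
  rewrite bits-none 0 m none (λ _ → refl) | bits-none 0 n none (λ _ → refl)
        | rsk-rows (rowWord g 0 m n (flip M)) | P-rows (letters (rowWord g′ 0 n m M))
        | sym (letters-bumpedᵇ [] (rowWord g′ 0 n m M)) | rec | bumᵀ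
  with bits 0 m (resting M none none n)
... | []    rewrite fin = refl
... | x ∷ r rewrite fin = cong ((g x ∷ map g r) ∷_) (smaller k len fin)
  where
  open GridProperties (grid M none none) admissible
  O : Matrix
  O i j = settle (M i j) (flight M none none i j) (resting M none none i j)
  w = rowWord g′ 0 n m M
  -- The lower rows: the two readings output `O` and its transpose. The bound drops because an empty
  -- word cannot have the first row `x ∷ r`.
  smaller : ∀ k → length (letters w) ≤ k → final [] (letters w) ≡ x ∷ r →
            proj₂ (rsk (rowWord g 0 m n (flip O))) ≡ map (map g) (P (letters (bumpedᵇ [] w)))
  smaller zero len e with letters w
  smaller zero len () | []
  smaller (suc k) len _ =
    trans (rsk-transpose g g′ n m k out-unique
             (GridProperties.out-unique (transpose (grid M none none)) (transpose-admissible admissible))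
             (subst (λ w → length w ≤ k) (trans (sym (letters-bumpedᵇ [] w)) (cong letters bum))
                (length-bumped-[] (letters w) len)))
          (cong (map (map g) ∘ P ∘ letters) (sym bum))

-- Balls and boxes

does⁻ : ∀ {A : Set} (d : Dec A) → does d ≡ true → A
does⁻ (yes a) _ = a

true-ext : ∀ {a b} → (a ≡ true → b ≡ true) → (b ≡ true → a ≡ true) → a ≡ b
true-ext {false} {false} f g = refl
true-ext {false} {true}  f g = g refl
true-ext {true}  {false} f g = sym (f refl)
true-ext {true}  {true}  f g = refl

Distinct : ∀ {n} → Positions n → Set
Distinct s = ∀ {i j} → lookup s i ≡ lookup s j → i ≡ j

unique⇒distinct : ∀ {n} {s : Positions n} → Unique (toList s) → Distinct s
unique⇒distinct {s = x ∷ s} (p ∷ u) {zero}  {zero}  e = refl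
unique⇒distinct {s = x ∷ s} (p ∷ u) {zero}  {suc j} e = contradiction e (All.lookup p (∈-toList⁺ (∈-lookup j s)))
unique⇒distinct {s = x ∷ s} (p ∷ u) {suc i} {zero}  e = contradiction (sym e) (All.lookup p (∈-toList⁺ (∈-lookup i s)))
unique⇒distinct {s = x ∷ s} (p ∷ u) {suc i} {suc j} e = cong suc (unique⇒distinct u e)

-- Boxes are counted from a base box `b`, which makes them columns of a grid indexed by natural
-- numbers.
module Boxes (b : ℤ) where

  box : ℕ → ℤ
  box j = b ℤ.+ ℤ.+ j

  box-injective : ∀ {j k} → box j ≡ box k → j ≡ k
  box-injective e = ℤ.+-injective (∙-cancelˡ b _ _ e)

  box-suc : ∀ j → box j ℤ.+ 1ℤ ≡ box (suc j)
  box-suc j = trans (ℤ.+-assoc b (ℤ.+ j) 1ℤ) (cong (λ k → b ℤ.+ ℤ.+ k) (+-comm j 1))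

  Occupied : ∀ {n} → Positions n → ℕ → Set
  Occupied s j = ∃ λ i → lookup s i ≡ box j

  occupied? : ∀ {n} (s : Positions n) j → Dec (Occupied s j)
  occupied? s j = any? (λ i → lookup s i ℤ.≟ box j)

  occupied⁻ : ∀ {n} (s : Positions n) {x} → occupied (toList s) x ≡ true → ∃ λ i → lookup s i ≡ x
  occupied⁻ (y ∷ s) {x} e with y ℤ.≟ x
  ... | yes p = zero , p
  ... | no _  with occupied⁻ s e
  ...   | i , p = suc i , p

  -- The last conjunct records the default of `nextEmpty`: an occupied box can be returned only when
  -- the fuel has run out, and then its index is known.
  search : ∀ {n} f (s : Positions n) q → ∃ λ y → nextEmpty f (toList s) (box q) ≡ box y × q < y ×
           (∀ j → q < j → j < y → Occupied s j) × (Occupied s y → y ≡ suc (f + q))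
  search zero s q =
    suc q , box-suc q , ≤-refl , (λ j q<j j≤q → contradiction q<j (<⇒≱ j≤q)) , λ _ → refl
  search (suc f) s q rewrite box-suc q with occupied (toList s) (box (suc q)) in e
  ... | true with search f s (suc q)
  ...   | y , ey , q<y , between , full =
    y , ey , <-trans ≤-refl q<y , between′ , λ o → trans (full o) (cong suc (+-suc f q))
    where
    between′ : ∀ j → q < j → j < y → Occupied s j
    between′ j q<j j<y with m≤n⇒m<n∨m≡n q<j
    ... | inj₁ q+1<j = between j q+1<j j<y
    ... | inj₂ refl  = occupied⁻ s e
  search (suc f) s q | false =
    suc q , refl , ≤-refl , (λ j q<j j≤q → contradiction q<j (<⇒≱ j≤q)) , λ o → contradiction (occupied⁺ s o) (not-¬ e)
    where
    occupied⁺ : ∀ {n} (s : Positions n) → Occupied s (suc q) → occupied (toList s) (box (suc q)) ≡ true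
    occupied⁺ (y ∷ s) (zero , p) with y ℤ.≟ box (suc q)
    ... | yes _ = refl
    ... | no ¬p = contradiction p ¬p
    occupied⁺ (y ∷ s) (suc i , p) with y ℤ.≟ box (suc q)
    ... | yes _ = refl
    ... | no _  = occupied⁺ s (i , p)

  -- Fuel n + 1 suffices: n balls cannot fill n + 1 boxes.
  nextEmpty-spec : ∀ {n} (s : Positions n) q → ∃ λ y → nextEmpty (suc n) (toList s) (box q) ≡ box y ×
                   q < y × (∀ j → q < j → j < y → Occupied s j) × ¬ Occupied s y
  nextEmpty-spec {n} s q with search (suc n) s q
  ... | y , ey , q<y , between , full = y , ey , q<y , between , λ o → crowded o (full o)
    where
    crowded : Occupied s y → y ≡ suc (suc n + q) → ⊥
    crowded o refl with pigeonhole ≤-refl (λ t → proj₁ (ball t))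
      where
      ball : ∀ (t : Fin (suc n)) → Occupied s (suc (toℕ t + q))
      ball t = between _ (s≤s (m≤n+m q (toℕ t))) (s≤s (+-monoˡ-≤ q (toℕ<n t)))
    ... | t , t′ , t<t′ , e =
      contradiction (+-cancelʳ-≡ q _ _ (suc-injective (box-injective
        (trans (sym (proj₂ (between _ (s≤s (m≤n+m q (toℕ t))) (s≤s (+-monoˡ-≤ q (toℕ<n t))))))
        (trans (cong (lookup s) e)
               (proj₂ (between _ (s≤s (m≤n+m q (toℕ t′))) (s≤s (+-monoˡ-≤ q (toℕ<n t′))))))))))
        (<⇒≢ t<t′)

  Ball : ∀ {n} → Positions n → ℕ → ℕ → Set
  Ball s c j = ∃ λ i → colour i ≡ c × lookup s i ≡ box j

  ball? : ∀ {n} (s : Positions n) c j → Dec (Ball s c j)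
  ball? s c j = any? (λ i → (colour i ≟ c) ×-dec (lookup s i ℤ.≟ box j))

  balls : ∀ {n} → Positions n → Matrix
  balls s c j = does (ball? s c j)

  empties : ∀ {n} → Positions n → Bits
  empties s j = not (does (occupied? s j))

  balls⁻ : ∀ {n} (s : Positions n) {c j} → balls s c j ≡ true → Ball s c j
  balls⁻ s e = does⁻ (ball? s _ _) e

  balls⁺ : ∀ {n} (s : Positions n) i {j} → lookup s i ≡ box j → balls s (colour i) j ≡ true
  balls⁺ s i e = dec-true (ball? s _ _) (i , refl , e)

  colour-injective : ∀ {n} {i j : Fin n} → colour i ≡ colour j → i ≡ j
  colour-injective e = toℕ-injective (suc-injective e)

  balls-row-unique : ∀ {n} (s : Positions n) → RowUnique (balls s)
  balls-row-unique s p q with balls⁻ s p | balls⁻ s q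
  ... | i , refl , e | i′ , c , e′ with colour-injective c
  ... | refl = box-injective (trans (sym e) e′)

  balls-col-unique : ∀ {n} {s : Positions n} → Distinct s → RowUnique (flip (balls s))
  balls-col-unique {s = s} d p q with balls⁻ s p | balls⁻ s q
  ... | i , refl , e | i′ , refl , e′ = cong colour (d (trans e (sym e′)))

  -- One step of time evolution as a grid.

  module Dynamics {n} (s : Positions n) (d : Distinct s) (start : Fin n → ℕ)
                  (start-box : ∀ i → lookup s i ≡ box (start i)) where

    -- F c j: the ball of colour c passes over or lands in box j; R c j: box j is empty when colour c moves.
    M F R O : Matrix
    M = balls s
    F = flight M none (empties s)
    R = resting M none (empties s)
    O i j = settle (M i j) (F i j) (R i j)

    G : Grid M F R O
    G = grid M none (empties s)

    A : Admissible M F R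
    A = record
      { row-unique = balls-row-unique s
      ; col-unique = balls-col-unique {s = s} d
      ; left-clear = λ _ → refl
      ; top-clear  = λ {_} {j} m → top j (balls⁻ s m)
      }
      where
      top : ∀ {c} j → Ball s c j → empties s j ≡ false
      top j (i , _ , e) = cong not (dec-true (occupied? s j) (i , e))

    open GridProperties G A

    -- The situation after colours 1 to `k` have moved: row `suc k` of `R`, which the next colour
    -- meets, marks the empty boxes of `st`.
    record Invariant (k : ℕ) (st : Positions n) : Set where
      field
        unmoved  : ∀ i → k ≤ toℕ i → lookup st i ≡ lookup s i
        moved    : ∀ i → toℕ i < k → ∃ λ j → lookup st i ≡ box j × O (colour i) j ≡ true
        empty    : ∀ j → R (suc k) j ≡ true → ¬ Occupied st j
        nonempty : ∀ j → R (suc k) j ≡ false → Occupied st j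
        distinct : Distinct st

    M-start : ∀ i → M (colour i) (start i) ≡ true
    M-start i = balls⁺ s i (start-box i)

    M-start⁻ : ∀ {i j} → M (colour i) j ≡ true → j ≡ start i
    M-start⁻ m = balls-row-unique s m (M-start _)

    -- In row `c` the flight starts at the ball's box `q`, passes the occupied boxes and settles at
    -- the first empty one, `y`; meanwhile `R` gains `q` and loses `y`.
    move-invariant : ∀ i {st} → Invariant (toℕ i) st → Invariant (suc (toℕ i)) (moveBall st i)
    move-invariant i {st} I = go (nextEmpty-spec st q)
      where
      open Invariant I
      c = colour i
      q = start i
      at-q : lookup st i ≡ box q
      at-q = trans (unmoved i ≤-refl) (start-box i)
      go : (∃ λ y → nextEmpty (suc n) (toList st) (box q) ≡ box y × q < y ×
             (∀ j → q < j → j < y → Occupied st j) × ¬ Occupied st y) →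
           Invariant (suc (toℕ i)) (moveBall st i)
      go (y , ey , q<y , between , ¬occ) rewrite at-q | ey = record
        { unmoved  = λ i′ i<i′ → trans (lookup∘update′ (λ e → <⇒≢ i<i′ (cong toℕ (sym e))) st (box y))
                                       (unmoved i′ (<⇒≤ i<i′))
        ; moved    = moved′
        ; empty    = empty′
        ; nonempty = nonempty′
        ; distinct = distinct′
        }
        where
        st′ = st [ i ]≔ box y

        R-occupied : ∀ {j} → Occupied st j → R c j ≡ false
        R-occupied {j} o with R c j in e
        ... | true  = contradiction o (empty j e)
        ... | false = refl

        F-between : ∀ j → q < j → j ≤ y → F c j ≡ true
        F-between (suc j) q<j j≤y with m≤n⇒m<n∨m≡n q<j
        ... | inj₂ refl rewrite M-start i = refl
        ... | inj₁ (s≤s q<j′)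
          rewrite F-between j q<j′ (<⇒≤ j≤y) | R-occupied (between j q<j′ j≤y) = ∨-zeroʳ (M c j)

        M-y : M c y ≡ false
        M-y with M c y in e
        ... | true  = contradiction (sym (M-start⁻ e)) (<⇒≢ q<y)
        ... | false = refl

        R-y : R c y ≡ true
        R-y with R c y in e
        ... | true  = refl
        ... | false = contradiction (nonempty y e) ¬occ

        O-y : O c y ≡ true
        O-y rewrite M-y | F-between y q<y ≤-refl | R-y = refl

        moved′ : ∀ i′ → toℕ i′ < suc (toℕ i) → ∃ λ j → lookup st′ i′ ≡ box j × O (colour i′) j ≡ true
        moved′ i′ (s≤s i′≤i) with i′ Fin.≟ i
        ... | yes refl = y , lookup∘update i st (box y) , O-y
        ... | no i′≢i with moved i′ (≤∧≢⇒< i′≤i (i′≢i ∘ toℕ-injective))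
        ...   | j , e , o = j , trans (lookup∘update′ i′≢i st (box y)) e , o

        ¬occupied-q : ¬ Occupied st′ q
        ¬occupied-q (i′ , e) with i′ Fin.≟ i
        ... | yes refl = <⇒≢ q<y (sym (box-injective (trans (sym (lookup∘update i st (box y))) e)))
        ... | no i′≢i  = i′≢i (distinct (trans (trans (sym (lookup∘update′ i′≢i st (box y))) e) (sym at-q)))

        ¬occupied-other : ∀ {j} → R c j ≡ true → F c j ≡ false → ¬ Occupied st′ j
        ¬occupied-other {j} r f (i′ , e) with i′ Fin.≟ i
        ... | no i′≢i = empty j r (i′ , trans (sym (lookup∘update′ i′≢i st (box y))) e)
        ... | yes refl with box-injective (trans (sym (lookup∘update i st (box y))) e)
        ...   | refl = contradiction (trans (sym f) (F-between y q<y ≤-refl)) λ ()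

        empty′ : ∀ j → R (suc c) j ≡ true → ¬ Occupied st′ j
        empty′ j r with M c j in m | R c j in r₀ | F c j in f
        ... | true  | _    | _     = subst (¬_ ∘ Occupied st′) (sym (M-start⁻ m)) ¬occupied-q
        ... | false | true | false = ¬occupied-other r₀ f

        nonempty′ : ∀ j → R (suc c) j ≡ false → Occupied st′ j
        nonempty′ j r with M c j in m | R c j in r₀ | F c j in f
        -- A box that was free and is so no longer is a settling place, and row `c` has only one.
        ... | false | true  | true
          with refl ← out-unique O-y (cong₂ _∧_ (cong not m) (cong₂ _∧_ f r₀)) =
          i , lookup∘update i st (box y)
        ... | false | false | _ with nonempty j r₀
        ...   | i′ , e with i′ Fin.≟ i
        ...     | no i′≢i = i′ , trans (lookup∘update′ i′≢i st (box y)) e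
        ...     | yes refl with box-injective (trans (sym at-q) e)
        ...       | refl = contradiction (trans (sym m) (M-start i)) λ ()

        distinct′ : Distinct st′
        distinct′ {i₁} {i₂} e with i₁ Fin.≟ i | i₂ Fin.≟ i
        ... | yes refl | yes refl = refl
        ... | no ne₁ | no ne₂ =
          distinct (trans (sym (lookup∘update′ ne₁ st (box y))) (trans e (lookup∘update′ ne₂ st (box y))))
        ... | yes refl | no ne₂ = contradiction
          (i₂ , trans (sym (lookup∘update′ ne₂ st (box y))) (trans (sym e) (lookup∘update i st (box y)))) ¬occ
        ... | no ne₁ | yes refl = contradiction
          (i₁ , trans (sym (lookup∘update′ ne₁ st (box y))) (trans e (lookup∘update i st (box y)))) ¬occ

    -- The tail of a `tabulate` is the `tabulate` of a shifted function, hence the general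
    -- enumeration `h` of the colours from `k` on.
    moves-invariant : ∀ l k (h : Fin l → Fin n) → (∀ t → toℕ (h t) ≡ k + toℕ t) → ∀ {st} →
                      Invariant k st → Invariant (k + l) (foldl moveBall st (toList (V.tabulate h)))
    moves-invariant zero    k h e I = subst (λ k → Invariant k _) (sym (+-identityʳ k)) I
    moves-invariant (suc l) k h e {st} I =
      subst (λ k → Invariant k (foldl moveBall st (toList (V.tabulate h)))) (sym (+-suc k l))
        (moves-invariant l (suc k) (h ∘ suc) (λ t → trans (e (suc t)) (+-suc k (toℕ t)))
          (subst (λ k → Invariant (suc k) (moveBall st (h zero))) e₀
            (move-invariant (h zero) (subst (λ k → Invariant k st) (sym e₀) I))))
      where
      e₀ : toℕ (h zero) ≡ k
      e₀ = trans (e zero) (+-identityʳ k)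

    initial : Invariant 0 s
    initial = record
      { unmoved  = λ _ _ → refl
      ; moved    = λ _ ()
      ; empty    = λ j r o → contradiction
          (trans (sym (cong not (dec-true (occupied? s j) o))) (trans (sym (R₁ j)) r)) λ ()
      ; nonempty = λ j r → does⁻ (occupied? s j) (not-injective (trans (sym (R₁ j)) r))
      ; distinct = d
      }
      where
      -- Colours start at 1, so row 0 has no entry and hands the empty boxes unchanged to row 1.
      M₀ : ∀ j → M 0 j ≡ false
      M₀ j with M 0 j in m
      ... | false = refl
      ... | true with balls⁻ s m
      ...   | _ , () , _
      F₀ : ∀ j → F 0 j ≡ false
      F₀ zero    = refl
      F₀ (suc j) rewrite M₀ j | F₀ j = refl
      R₁ : ∀ j → R 1 j ≡ empties s j
      R₁ j rewrite M₀ j | F₀ j = ∧-identityʳ _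

    open Invariant (moves-invariant n 0 (λ i → i) (λ _ → refl) initial)
      using () renaming (moved to T-moved; distinct to T-distinct) public

    -- For the converse, an output traces back to an entry of its row, hence to a ball; that ball
    -- lands at an output of the row, and there is only one.
    balls-T≡O : ∀ c j → balls (T s) c j ≡ O c j
    balls-T≡O c j = true-ext to from
      where
      to : balls (T s) c j ≡ true → O c j ≡ true
      to m with balls⁻ (T s) m
      ... | i , refl , e with T-moved i (toℕ<n i)
      ... | _ , e′ , o with box-injective (trans (sym e) e′)
      ... | refl = o
      from : O c j ≡ true → balls (T s) c j ≡ true
      from o with Row.settled c o
      ... | f , _ with Row.source c {j = j} z≤n f
      ... | inj₂ (_ , _ , _ , m) with balls⁻ s m
      ... | i , refl , _ with T-moved i (toℕ<n i)
      ... | _ , e′ , o′ with out-unique o o′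
      ... | refl = balls⁺ (T s) i e′

    T-grid : Grid M F R (balls (T s))
    T-grid = record { right = Grid.right G ; down = Grid.down G ; out = balls-T≡O }

    -- Each ball lands before box `m`, which ends its flight; a flight crossing `m` would need a
    -- second ball of the colour. So the carrier leaves the window empty.
    F-lands : ∀ {m} → (∀ i → ∃ λ j → j < m × lookup (T s) i ≡ box j) → ∀ c → F c m ≡ false
    F-lands {m} inside c with F c m in f
    ... | false = refl
    ... | true with Row.source c {j = m} z≤n f
    ... | inj₂ (q , _ , _ , p) with balls⁻ s p
    ... | i , refl , _ with T-moved i (toℕ<n i) | inside i
    ... | y , e , o | j , j<m , e′ with box-injective (trans (sym e) e′)
    ... | refl with Row.settled c o
    ... | fy , _ , fsy with Row.source c j<m f | Row.source c z≤n fy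
    ... | inj₁ t | _ = contradiction (trans (sym fsy) t) λ ()
    ... | inj₂ (_ , y<q , _ , m₁) | inj₂ (_ , _ , q<y , m₂) =
      contradiction (balls-row-unique s m₂ m₁) (<⇒≢ (<-trans q<y y<q))

-- The bi-word as a sorted list.

infix 4 _≺_

_≺_ : ℤ × ℕ → ℤ × ℕ → Set
p ≺ q = proj₁ p ℤ.< proj₁ q

-- Reduces the identification of `biword s` with the word of a matrix to a comparison of members.
≺-sorted-ext : ∀ {v w} → AllPairs _≺_ v → AllPairs _≺_ w →
               (∀ {p} → p ∈ v → p ∈ w) → (∀ {p} → p ∈ w → p ∈ v) → v ≡ w
≺-sorted-ext [] [] f g = refl
≺-sorted-ext [] (_ ∷ _) f g with () ← g (here refl)
≺-sorted-ext (_ ∷ _) [] f g with () ← f (here refl)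
≺-sorted-ext {p ∷ v} {q ∷ w} (p≺v ∷ sv) (q≺w ∷ sw) f g = cong₂ _∷_ p≡q
  (≺-sorted-ext sv sw (λ i → tail p≺v (sym p≡q) i (f (there i))) (λ i → tail q≺w p≡q i (g (there i))))
  where
  p≡q : p ≡ q
  p≡q with f (here refl) | g (here refl)
  ... | here e | _ = e
  ... | _ | here e = sym e
  ... | there i | there j = contradiction (All.lookup p≺v j) (ℤ.<-asym (All.lookup q≺w i))
  tail : ∀ {r p q v w} → All (p ≺_) v → q ≡ p → r ∈ v → r ∈ q ∷ w → r ∈ w
  tail p≺v refl i (here refl) = contradiction (All.lookup p≺v i) (ℤ.<-irrefl refl)
  tail p≺v refl i (there j)   = j

∈-insertByPos⁺ : ∀ {r} p w → r ∈ p ∷ w → r ∈ insertByPos p w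
∈-insertByPos⁺ p [] i = i
∈-insertByPos⁺ p (q ∷ w) i with proj₁ p ℤ.≤ᵇ proj₁ q
∈-insertByPos⁺ p (q ∷ w) i                 | true  = i
∈-insertByPos⁺ p (q ∷ w) (here e)          | false = there (∈-insertByPos⁺ p w (here e))
∈-insertByPos⁺ p (q ∷ w) (there (here e))  | false = here e
∈-insertByPos⁺ p (q ∷ w) (there (there i)) | false = there (∈-insertByPos⁺ p w (there i))

∈-insertByPos⁻ : ∀ {r} p w → r ∈ insertByPos p w → r ∈ p ∷ w
∈-insertByPos⁻ p [] i = i
∈-insertByPos⁻ p (q ∷ w) i with proj₁ p ℤ.≤ᵇ proj₁ q
∈-insertByPos⁻ p (q ∷ w) i         | true  = i
∈-insertByPos⁻ p (q ∷ w) (here e)  | false = there (here e)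
∈-insertByPos⁻ p (q ∷ w) (there i) | false with ∈-insertByPos⁻ p w i
... | here e  = here e
... | there j = there (there j)

∈-sortByPos⁺ : ∀ {r} w → r ∈ w → r ∈ sortByPos w
∈-sortByPos⁺ (p ∷ w) (here e)  = ∈-insertByPos⁺ p (sortByPos w) (here e)
∈-sortByPos⁺ (p ∷ w) (there i) = ∈-insertByPos⁺ p (sortByPos w) (there (∈-sortByPos⁺ w i))

∈-sortByPos⁻ : ∀ {r} w → r ∈ sortByPos w → r ∈ w
∈-sortByPos⁻ (p ∷ w) i with ∈-insertByPos⁻ p (sortByPos w) i
... | here e  = here e
... | there j = there (∈-sortByPos⁻ w j)

insertByPos-sorted : ∀ p w → AllPairs _≺_ w → All (λ q → proj₁ p ≢ proj₁ q) w →
                     AllPairs _≺_ (insertByPos p w)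
insertByPos-sorted p [] _ _ = [] ∷ []
insertByPos-sorted p (q ∷ w) (q≺w ∷ s) (p≢q ∷ p≢w) with proj₁ p ℤ.≤ᵇ proj₁ q in e
... | true  = (p<q ∷ All.map (ℤ.<-trans p<q) q≺w) ∷ (q≺w ∷ s)
  where p<q = ℤ.≤∧≢⇒< (ℤ.≤ᵇ⇒≤ (subst Bool.T (sym e) _)) p≢q
... | false = All.tabulate (λ i → q≺ (∈-insertByPos⁻ p w i)) ∷ insertByPos-sorted p w s p≢w
  where
  q≺ : ∀ {r} → r ∈ p ∷ w → q ≺ r
  q≺ (here refl) = ℤ.≰⇒> λ p≤q → subst Bool.T e (ℤ.≤⇒≤ᵇ p≤q)
  q≺ (there i)   = All.lookup q≺w i

sortByPos-sorted : ∀ w → AllPairs (λ p q → proj₁ p ≢ proj₁ q) w → AllPairs _≺_ (sortByPos w)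
sortByPos-sorted []      _        = []
sortByPos-sorted (p ∷ w) (ne ∷ d) =
  insertByPos-sorted p _ (sortByPos-sorted w d) (All.tabulate (λ i → All.lookup ne (∈-sortByPos⁻ w i)))

∈-rowWord⁺ : ∀ g {m M} k l {h c} → k ≤ h → h < k + l → c ∈ bits 0 m (M h) → (g h , c) ∈ rowWord g k l m M
∈-rowWord⁺ g k zero k≤h h<k i rewrite +-identityʳ k = contradiction k≤h (<⇒≱ h<k)
∈-rowWord⁺ g {m} {M} k (suc l) {h} k≤h h<k i with m≤n⇒m<n∨m≡n k≤h
... | inj₂ refl = ∈-++⁺ˡ (∈-map⁺ (g k ,_) i)
... | inj₁ k<h  = ∈-++⁺ʳ (map (g k ,_) (bits 0 m (M k)))
                    (∈-rowWord⁺ g (suc k) l k<h (subst (h <_) (+-suc k l) h<k) i)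

∈-rowWord⁻ : ∀ g {m M} k l {x c} → (x , c) ∈ rowWord g k l m M →
             ∃ λ h → k ≤ h × h < k + l × x ≡ g h × c ∈ bits 0 m (M h)
∈-rowWord⁻ g {m} {M} k (suc l) i rewrite +-suc k l with ∈-++⁻ (map (g k ,_) (bits 0 m (M k))) i
... | inj₁ i′ with ∈-map⁻ (g k ,_) i′
...   | _ , c∈ , refl = k , ≤-refl , s≤s (m≤m+n k l) , refl , c∈
∈-rowWord⁻ g k (suc l) i | inj₂ i′ with ∈-rowWord⁻ g (suc k) l i′
... | h , k<h , h< , e , c∈ = h , <⇒≤ k<h , h< , e , c∈

rowWord-sorted : ∀ {g} → (∀ {h h′} → h < h′ → g h ℤ.< g h′) → ∀ {M} m k l → RowUnique M →
                 AllPairs _≺_ (rowWord g k l m M)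
rowWord-sorted g-mono m k zero u = []
rowWord-sorted {g} g-mono {M} m k (suc l) u with unique-bits {M k} 0 m u
... | inj₁ e rewrite e = rowWord-sorted g-mono m (suc k) l u
... | inj₂ (q , e , _) rewrite e =
  All.tabulate (λ i → after (∈-rowWord⁻ g (suc k) l i)) ∷ rowWord-sorted g-mono m (suc k) l u
  where
  after : ∀ {x c} → (∃ λ h → k < h × h < suc k + l × x ≡ g h × c ∈ bits 0 m (M h)) → g k ℤ.< x
  after (h , k<h , _ , refl , _) = g-mono k<h

toList-tabulate : ∀ {A : Set} {n} (f : Fin n → A) → toList (V.tabulate f) ≡ List.tabulate f
toList-tabulate {n = zero}  f = refl
toList-tabulate {n = suc n} f = cong (f zero ∷_) (toList-tabulate (f ∘ suc))

-- Colour words and position words of states.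

module Words (b : ℤ) where
  open Boxes b public

  InRange : ∀ {n} → ℕ → Positions n → Set
  InRange m s = ∀ i → ∃ λ j → j < m × lookup s i ≡ box j

  biword-rows : ∀ {n} m (s : Positions n) → Distinct s → InRange m s →
                biword s ≡ rowWord box 0 m (suc n) (flip (balls s))
  biword-rows {n} m s d inside rewrite sym (tabulate-allFin (λ i → lookup s i , colour i))
                                     | toList-tabulate (λ i → lookup s i , colour i) =
    ≺-sorted-ext (sortByPos-sorted _ (tabulate⁺ λ ne e → ne (d e)))
                 (rowWord-sorted (λ h<h′ → ℤ.+-monoʳ-< b (ℤ.+<+ h<h′)) (suc n) 0 m (balls-col-unique {s = s} d))
                 to from
    where
    w : Biword
    w = List.tabulate (λ i → lookup s i , colour i)
    to : ∀ {p} → p ∈ sortByPos w → p ∈ rowWord box 0 m (suc n) (flip (balls s))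
    to i with ∈-tabulate⁻ (∈-sortByPos⁻ w i)
    ... | t , refl with inside t
    ... | j , j<m , e = subst (λ x → (x , colour t) ∈ rowWord box 0 m (suc n) (flip (balls s))) (sym e)
      (∈-rowWord⁺ box 0 m z≤n j<m (∈-bits⁺ (suc n) z≤n (s≤s (toℕ<n t)) (balls⁺ s t e)))
    from : ∀ {p} → p ∈ rowWord box 0 m (suc n) (flip (balls s)) → p ∈ sortByPos w
    from i with ∈-rowWord⁻ box 0 m i
    ... | h , _ , _ , refl , c∈ with balls⁻ s (proj₂ (proj₂ (∈-bits⁻ (suc n) c∈)))
    ... | t , refl , e = ∈-sortByPos⁺ w (subst (λ x → (x , colour t) ∈ w) e (∈-tabulate⁺ t))

  -- The boxes in order of colour, that is, the bottom row of the inverse bi-word. There are `suc n`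
  -- rows because colours run from 1 to `n`.
  positionWord : ∀ {n} → ℕ → Positions n → Word
  positionWord {n} m s = letters (rowWord ℤ.+_ 0 (suc n) m (balls s))

  Psym-word : ∀ {n} m (s : Positions n) → Distinct s → InRange m s →
              Psym s ≡ P (letters (rowWord box 0 m (suc n) (flip (balls s))))
  Psym-word m s d inside =
    trans (cong (proj₁ ∘ rsk) (biword-rows m s d inside)) (rsk-P (rowWord box 0 m _ (flip (balls s))))

  Qsym-positionWord : ∀ {n} m (s : Positions n) → Distinct s → InRange m s →
                      Qsym s ≡ map (map box) (P (positionWord m s))
  Qsym-positionWord m s d inside = trans (cong (proj₂ ∘ rsk) (biword-rows m s d inside))
    (rsk-transpose box ℤ.+_ _ m _ (balls-row-unique s) (balls-col-unique {s = s} d) ≤-refl)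

  ∈-positionWord⁺ : ∀ {n} {m} (s : Positions n) {j} → j < m → Occupied s j → j ∈ positionWord m s
  ∈-positionWord⁺ {n} s j<m (i , e) =
    ∈-map⁺ proj₂ (∈-rowWord⁺ ℤ.+_ 0 (suc n) z≤n (s≤s (toℕ<n i)) (∈-bits⁺ _ z≤n j<m (balls⁺ s i e)))

  ∈-positionWord⁻ : ∀ {n} m (s : Positions n) {j} → j ∈ positionWord m s → Occupied s j
  ∈-positionWord⁻ {n} m s i with ∈-map⁻ proj₂ i
  ... | _ , i′ , refl with ∈-rowWord⁻ ℤ.+_ 0 (suc n) i′
  ... | _ , _ , _ , _ , j∈ with balls⁻ s (proj₂ (proj₂ (∈-bits⁻ m j∈)))
  ... | t , _ , e = t , e

  module _ {n} (s : Positions n) (d : Distinct s) (m : ℕ) (inside : InRange m s) (T-inside : InRange m (T s)) where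
    private module Dyn = Dynamics s d (proj₁ ∘ inside) (proj₂ ∘ proj₂ ∘ inside)

    T-distinct : Distinct (T s)
    T-distinct = Dyn.T-distinct

    -- Reading the grid by columns, the carrier starts and ends empty.
    T-Psym : Psym (T s) ≡ Psym s
    T-Psym = begin
      Psym (T s)                                                       ≡⟨ Psym-word m (T s) Dyn.T-distinct T-inside ⟩
      P (letters (rowWord box 0 m (suc n) (flip (balls (T s)))))       ≡⟨ ~⇒P≡ same ⟨
      P (letters (rowWord box 0 m (suc n) (flip (balls s))))           ≡⟨ Psym-word m s d inside ⟨
      Psym s                                                           ∎
      where
      open ≡-Reasoning
      same : letters (rowWord box 0 m (suc n) (flip (balls s))) ~
             letters (rowWord box 0 m (suc n) (flip (balls (T s))))
      same with GridProperties.rows-~ (transpose Dyn.T-grid) (transpose-admissible Dyn.A) (suc n) box 0 m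
      ... | e rewrite bits-none 0 (suc n) (λ c → Dyn.F c 0) (λ _ → refl)
                    | bits-none 0 (suc n) (λ c → Dyn.F c m) (λ {c} _ → Dyn.F-lands T-inside c) =
        ~-trans e (≡⇒~ (++-identityʳ _))

    -- Inserting a ball's box into the row of empty boxes frees that box and bumps the next empty
    -- one, where the ball lands.
    positionWord-T : bumped (bits 0 m (empties s)) (positionWord m s) ≡ positionWord m (T s)
    positionWord-T = trans (sym (letters-bumpedᵇ _ (rowWord ℤ.+_ 0 (suc n) m (balls s))))
      (cong letters (proj₂ (proj₂ (GridProperties.rows-run Dyn.T-grid Dyn.A m ℤ.+_ (λ _ → refl) 0 (suc n)))))

  occupied-transfer : ∀ {n m x} (s s′ : Positions n) → x < m →
                      (x ∈ positionWord m s → x ∈ positionWord m s′) →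
                      does (occupied? s x) ≡ true → does (occupied? s′ x) ≡ true
  occupied-transfer s s′ x<m f o =
    dec-true (occupied? s′ _) (∈-positionWord⁻ _ s′ (f (∈-positionWord⁺ s x<m (does⁻ (occupied? s _) o))))

  -- Equivalent position words have the same letters, so both states have the same empty boxes in
  -- the window; `~⇒≈` then applies to one common row.
  positionWord-~-T : ∀ {n} {s₁ s₂ : Positions n} (d₁ : Distinct s₁) (d₂ : Distinct s₂) {m} →
    InRange m s₁ → InRange m (T s₁) → InRange m s₂ → InRange m (T s₂) →
    positionWord m s₁ ~ positionWord m s₂ → positionWord m (T s₁) ~ positionWord m (T s₂)
  positionWord-~-T {s₁ = s₁} {s₂} d₁ d₂ {m} r₁ r₁′ r₂ r₂′ e
    with _ , e′ ← ~⇒≈ (bits-sorted 0 m (empties s₁)) e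
    rewrite positionWord-T s₁ d₁ m r₁ r₁′
          | bits-cong 0 m (empties s₁) (empties s₂) (λ x<m → cong not
              (true-ext (occupied-transfer s₁ s₂ x<m (proj₁ (~⇒∈ e))) (occupied-transfer s₂ s₁ x<m (proj₂ (~⇒∈ e)))))
          | positionWord-T s₂ d₂ m r₂ r₂′ = e′

  T-Qsym : ∀ {n} {s₁ s₂ : Positions n} (d₁ : Distinct s₁) (d₂ : Distinct s₂) {m} →
    InRange m s₁ → InRange m (T s₁) → InRange m s₂ → InRange m (T s₂) →
    Qsym s₁ ≡ Qsym s₂ → Qsym (T s₁) ≡ Qsym (T s₂)
  T-Qsym {s₁ = s₁} {s₂} d₁ d₂ {m} r₁ r₁′ r₂ r₂′ e = begin
    Qsym (T s₁)                              ≡⟨ Qsym-positionWord m (T s₁) (T-distinct s₁ d₁ m r₁ r₁′) r₁′ ⟩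
    map (map box) (P (positionWord m (T s₁))) ≡⟨ cong (map (map box)) (~⇒P≡ T-~) ⟩
    map (map box) (P (positionWord m (T s₂))) ≡⟨ Qsym-positionWord m (T s₂) (T-distinct s₂ d₂ m r₂ r₂′) r₂′ ⟨
    Qsym (T s₂)                              ∎
    where
    open ≡-Reasoning
    P-equal : P (positionWord m s₁) ≡ P (positionWord m s₂)
    P-equal = map-injective (map-injective box-injective)
      (trans (sym (Qsym-positionWord m s₁ d₁ r₁)) (trans e (Qsym-positionWord m s₂ d₂ r₂)))
    T-~ : positionWord m (T s₁) ~ positionWord m (T s₂)
    T-~ = positionWord-~-T d₁ d₂ r₁ r₁′ r₂ r₂′ (P≡⇒~ P-equal)

-- A finite window containing all balls.

radius : ∀ {n} → Positions n → ℕ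
radius []      = 0
radius (x ∷ s) = ℤ.∣ x ∣ + radius s

∣x∣≤⇒box : ∀ {B} x → ℤ.∣ x ∣ ≤ B → ∃ λ j → j < suc (B + B) × x ≡ Boxes.box (ℤ.- ℤ.+ B) j
∣x∣≤⇒box {B} (ℤ.+ k) k≤B = B + k , s≤s (+-monoʳ-≤ B k≤B) , (begin
  ℤ.+ k                  ≡⟨ cong ℤ.+_ (m+n∸m≡n B k) ⟨
  ℤ.+ (B + k ∸ B)        ≡⟨ ℤ.⊖-≥ (m≤m+n B k) ⟨
  (B + k) ℤ.⊖ B          ≡⟨ ℤ.-m+n≡n⊖m B (B + k) ⟨
  ℤ.- ℤ.+ B ℤ.+ ℤ.+ (B + k) ∎)
  where open ≡-Reasoning
∣x∣≤⇒box {B} ℤ.-[1+ k ] k<B = B ∸ suc k , s≤s (≤-trans (m∸n≤m B (suc k)) (m≤m+n B B)) , (begin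
  ℤ.-[1+ k ]                     ≡⟨ cong (λ h → ℤ.- ℤ.+ h) (m∸[m∸n]≡n k<B) ⟨
  ℤ.- ℤ.+ (B ∸ (B ∸ suc k))      ≡⟨ ℤ.⊖-≤ (m∸n≤m B (suc k)) ⟨
  (B ∸ suc k) ℤ.⊖ B              ≡⟨ ℤ.-m+n≡n⊖m B (B ∸ suc k) ⟨
  ℤ.- ℤ.+ B ℤ.+ ℤ.+ (B ∸ suc k)  ∎)
  where open ≡-Reasoning

radius≤⇒inRange : ∀ {n B} (s : Positions n) → radius s ≤ B → Words.InRange (ℤ.- ℤ.+ B) (suc (B + B)) s
radius≤⇒inRange s r i = ∣x∣≤⇒box (lookup s i) (≤-trans (bound s i) r)
  where
  bound : ∀ {n} (s : Positions n) i → ℤ.∣ lookup s i ∣ ≤ radius s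
  bound (x ∷ s) zero    = m≤m+n _ _
  bound (x ∷ s) (suc i) = ≤-trans (bound s i) (m≤n+m _ ℤ.∣ x ∣)

theorem3p1 : (n : ℕ) → n ≥ 1 →
    ((s : Positions n) → Unique (toList s) → Psym (T s) ≡ Psym s)
    × ((s₁ s₂ : Positions n) → Unique (toList s₁) → Unique (toList s₂) →
    Qsym s₁ ≡ Qsym s₂ → Qsym (T s₁) ≡ Qsym (T s₂))
theorem3p1 n _ =
  -- The window from box `-B` to box `B` must hold the state both before and after the step.
  (λ s u → let B = radius s + radius (T s) in
    Words.T-Psym (ℤ.- ℤ.+ B) s (unique⇒distinct u) (suc (B + B))
      (radius≤⇒inRange s (m≤m+n _ _)) (radius≤⇒inRange (T s) (m≤n+m _ (radius s)))) ,
  (λ s₁ s₂ u₁ u₂ →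
    -- All four states share one window, so that the position words of `s₁` and `s₂` are counted
    -- from the same base box.
    let B₁ = radius s₁ + radius (T s₁)
        B₂ = radius s₂ + radius (T s₂)
    in Words.T-Qsym (ℤ.- ℤ.+ (B₁ + B₂)) (unique⇒distinct u₁) (unique⇒distinct u₂)
         (radius≤⇒inRange s₁ (≤-trans (m≤m+n _ _) (m≤m+n B₁ B₂)))
         (radius≤⇒inRange (T s₁) (≤-trans (m≤n+m _ (radius s₁)) (m≤m+n B₁ B₂)))
         (radius≤⇒inRange s₂ (≤-trans (m≤m+n _ _) (m≤n+m B₂ B₁)))
         (radius≤⇒inRange (T s₂) (≤-trans (m≤n+m _ (radius s₂)) (m≤n+m B₂ B₁))))
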